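{- Let $\mathcal{H}=\{rrb,bbr,rby\}$. Then $h_2(n,\mathcal{H})=\lceil n/2\rceil+1$.
   Context: Here $n$ denotes the number of vertices of the complete graph $K_n$. Edge-colorings of $K_n$ use colors from $\{r,b,y\}$ (red, blue, yellow); they need not be proper, and not all colors need be used. A pattern is an edge-colored triangle, denoted by the multiset of the colors of its three edges; e.g. $rrb$ is the triangle with two red edges and one blue edge, $bbr$ has two blue edges and one red edge, and $rby$ is the rainbow triangle with one edge of each color. For a family $\mathcal{H}$ of patterns, $\operatorname{Forb}(n,\mathcal{H})$ is the set of all edge-colorings of $K_n$ with colors from $\{r,b,y\}$ in which no triangle has a coloring belonging to $\mathcal{H}$. For an edge-coloring $c$ of $K_n$, $h_2(c)$ is the maximum $k$ such that there is a set of $k$ vertices whose induced edges use at most two of the three colors. Finally, $h_2(n,\mathcal{H})=\min\{h_2(c): c\in\operatorname{Forb}(n,\mathcal{H})\}$.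
   Formalization: The formal statement assumes n ≥ 2; for n = 1 the formula fails, since h_2(1,H) = 1 while ⌈1/2⌉+1 = 2, and likewise for n = 0. -}

module Defs where

open import Data.Nat using (ℕ; _≤_)
open import Data.Fin using (Fin)
open import Data.Fin.Subset using (Subset; _∈_; ∣_∣)
open import Data.List using (List; []; _∷_)
open import Data.List.Relation.Unary.Any using (Any)
open import Data.List.Relation.Binary.Permutation.Propositional using (_↭_)
open import Data.Product using (_×_; ∃; ∃₂; ∃-syntax)
open import Data.Sum using (_⊎_)
open import Data.Vec using (Vec; []; _∷_; toList)
open import Relation.Binary.PropositionalEquality using (_≡_; _≢_)
open import Relation.Nullary using (¬_)

data Color : Set where
  r b y : Color

-- The diagonal values `color i i` carry no meaning: every definition below
-- only consults `color` at pairs of distinct vertices.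
record Coloring (n : ℕ) : Set where
  field
    color : Fin n → Fin n → Color
    color-sym : ∀ i j → color i j ≡ color j i

open Coloring public

-- Patterns are multisets of three colors, hence compared with _≈ₚ_, not _≡_.
Pattern : Set
Pattern = Vec Color 3

_≈ₚ_ : Pattern → Pattern → Set
p ≈ₚ q = toList p ↭ toList q

triangle : ∀ {n} → Coloring n → (i j k : Fin n) → Pattern
triangle c i j k = color c i j ∷ color c j k ∷ color c i k ∷ []

Forb : (n : ℕ) → List Pattern → Coloring n → Set
Forb n H c = ∀ i j k → i ≢ j → j ≢ k → i ≢ k → ¬ Any (triangle c i j k ≈ₚ_) H

-- The colors p and q are allowed to coincide.
AtMostTwoColors : ∀ {n} → Coloring n → Subset n → Set
AtMostTwoColors c S =
  ∃₂ λ p q → ∀ i j → i ∈ S → j ∈ S → i ≢ j → color c i j ≡ p ⊎ color c i j ≡ q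

IsMax : (ℕ → Set) → ℕ → Set
IsMax P m = P m × (∀ k → P k → k ≤ m)

IsMin : (ℕ → Set) → ℕ → Set
IsMin P m = P m × (∀ k → P k → m ≤ k)

-- Maxima and minima are given by their graphs: `h₂ c ≔ k` says that h₂(c)
-- equals k, and `h₂[ n , H ]≔ m` says that h₂(n, H) equals m (in particular
-- that the minimum is attained).
infix 4 h₂_≔_ h₂[_,_]≔_ _≈ₚ_

h₂_≔_ : ∀ {n} → Coloring n → ℕ → Set
h₂ c ≔ m = IsMax (λ k → ∃[ S ] (∣ S ∣ ≡ k × AtMostTwoColors c S)) m

h₂[_,_]≔_ : (n : ℕ) → List Pattern → ℕ → Set
h₂[ n , H ]≔ m = IsMin (λ k → ∃[ c ] (Forb n H c × (h₂ c ≔ k))) m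

rrb bbr rby : Pattern
rrb = r ∷ r ∷ b ∷ []
bbr = b ∷ b ∷ r ∷ []
rby = r ∷ b ∷ y ∷ []

{-# OPTIONS --safe #-}

-- All three triangles containing both red and blue are forbidden, so no vertex
-- meets both a red and a blue edge. Let R be the set of vertices meeting a red
-- edge: edges touching R avoid blue, edges touching its complement avoid red.
-- The larger of R and its complement has at least ⌈n/2⌉ vertices, and still
-- spans at most two colors after one outside vertex is added to it.
-- Conversely, take a red and a blue clique of sizes ⌈n/2⌉ and ⌊n/2⌋ joined by
-- yellow edges: a set with two vertices in each clique sees all three colors.
module Submission where

open import Data.Bool using (Bool; true; false)
open import Data.Bool.Properties using (¬-not)
open import Data.Nat using (ℕ; zero; suc; _≤_; _<_; _+_; _∸_; z≤n; s≤s; _≤?_; ⌈_/2⌉; ⌊_/2⌋)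
open import Data.Nat.Properties as ℕ using (module ≤-Reasoning)
open import Data.Fin using (Fin; zero; suc)
open import Data.Fin.Properties using (_≟_; any?)
open import Data.Fin.Subset
  using (Subset; inside; outside; _∈_; _∉_; _∪_; ∁; ⁅_⁆; ⊤; ∣_∣)
open import Data.Fin.Subset.Properties
  using (_∈?_; nonempty?; x∈p∪q⁻; x∈p∪q⁺; x∈⁅x⁆; x∈⁅y⁆⇒x≡y; x∈∁p⇒x∉p;
    x∉∁p⇒x∈p; p⊆q⇒∣p∣≤∣q∣; p⊂q⇒∣p∣<∣q∣; p⊆p∪q; ∪-identityʳ; ∣∁p∣≡n∸∣p∣; ∣⊤∣≡n)
open import Data.List using (List; []; _∷_)
open import Data.List.Membership.Propositional using () renaming (_∈_ to _∈ₗ_)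
open import Data.List.Relation.Binary.Permutation.Propositional using (↭-sym; ↭-trans; prep; swap; refl)
open import Data.List.Relation.Binary.Permutation.Propositional.Properties using (∈-resp-↭)
open import Data.List.Relation.Unary.Any using (Any; here; there)
open import Data.Product using (_×_; _,_; ∃-syntax; proj₁; proj₂)
open import Data.Sum using (_⊎_; inj₁; inj₂; [_,_]′)
open import Data.Vec using ([]; _∷_; lookup; tabulate; toList)
open import Data.Vec.Properties using ([]=⇒lookup; lookup⇒[]=; lookup∘tabulate)
open import Level using (Level)
open import Function using (_∘_)
open import Relation.Binary.Definitions using (DecidableEquality)
open import Relation.Binary.PropositionalEquality
  using (_≡_; _≢_; refl; sym; trans; cong; ≢-sym)
open import Relation.Nullary using (¬_; yes; no; contradiction; ¬?; _×-dec_)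
open import Relation.Nullary.Decidable using (does; dec-true; from-no)
open import Relation.Unary using (Pred; Decidable)
open import Defs

_≟ᶜ_ : DecidableEquality Color
r ≟ᶜ r = yes refl
r ≟ᶜ b = no λ ()
r ≟ᶜ y = no λ ()
b ≟ᶜ r = no λ ()
b ≟ᶜ b = yes refl
b ≟ᶜ y = no λ ()
y ≟ᶜ r = no λ ()
y ≟ᶜ b = no λ ()
y ≟ᶜ y = yes refl

open import Data.List.Membership.DecPropositional _≟ᶜ_ using () renaming (_∈?_ to _∈ₗ?_)

private
  variable
    ℓ : Level
    n : ℕ
    P S : Subset n
    i j k v w : Fin n

-- Subsets of the vertex set and their sizes

filter : {A : Pred (Fin n) ℓ} → Decidable A → Subset n
filter A? = tabulate (does ∘ A?)

∈-filter⁺ : {A : Pred (Fin n) ℓ} (A? : Decidable A) → A i → i ∈ filter A?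
∈-filter⁺ {i = i} A? a = lookup⇒[]= i _ (trans (lookup∘tabulate _ i) (dec-true (A? i) a))

∈-filter⁻ : {A : Pred (Fin n) ℓ} (A? : Decidable A) → i ∈ filter A? → A i
∈-filter⁻ {i = i} A? i∈ with A? i | trans (sym (lookup∘tabulate (does ∘ A?) i)) ([]=⇒lookup i∈)
... | yes a | _  = a
... | no _  | ()

∉⇒lookup : ∀ (P : Subset n) → i ∉ P → lookup P i ≡ false
∉⇒lookup {i = i} P i∉P = ¬-not (i∉P ∘ lookup⇒[]= i P)

∣p∪⁅x⁆∣≤1+∣p∣ : ∀ (P : Subset n) v → ∣ P ∪ ⁅ v ⁆ ∣ ≤ suc ∣ P ∣
∣p∪⁅x⁆∣≤1+∣p∣ (inside  ∷ P) zero    rewrite ∪-identityʳ P = ℕ.n≤1+n _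
∣p∪⁅x⁆∣≤1+∣p∣ (outside ∷ P) zero    rewrite ∪-identityʳ P = ℕ.≤-refl
∣p∪⁅x⁆∣≤1+∣p∣ (inside  ∷ P) (suc v) = s≤s (∣p∪⁅x⁆∣≤1+∣p∣ P v)
∣p∪⁅x⁆∣≤1+∣p∣ (outside ∷ P) (suc v) = ∣p∪⁅x⁆∣≤1+∣p∣ P v

x∉p⇒∣p∣<∣p∪⁅x⁆∣ : v ∉ P → ∣ P ∣ < ∣ P ∪ ⁅ v ⁆ ∣
x∉p⇒∣p∣<∣p∪⁅x⁆∣ {v = v} v∉P =
  p⊂q⇒∣p∣<∣q∣ (p⊆p∪q _ , v , x∈p∪q⁺ (inj₂ (x∈⁅x⁆ v)) , v∉P)

-- If some `v` in `S` lies outside `P` but no two such vertices exist, then `S` is contained in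
-- `P ∪ ⁅ v ⁆`.
twoOutside-or-small : ∀ (S P : Subset n) →
  (∃[ v ] ∃[ w ] (v ∈ S × w ∈ S × v ≢ w × v ∉ P × w ∉ P)) ⊎ ∣ S ∣ ≤ suc ∣ P ∣
twoOutside-or-small S P with any? (λ v → any? (λ w →
    (v ∈? S) ×-dec (w ∈? S) ×-dec ¬? (v ≟ w) ×-dec ¬? (v ∈? P) ×-dec ¬? (w ∈? P)))
... | yes pair = inj₁ pair
... | no noPair with any? (λ v → (v ∈? S) ×-dec ¬? (v ∈? P))
...   | no none = inj₂ (ℕ.m≤n⇒m≤1+n (p⊆q⇒∣p∣≤∣q∣ S⊆P))
  where
  S⊆P : ∀ {x} → x ∈ S → x ∈ P
  S⊆P {x} x∈S with x ∈? P
  ... | yes x∈P = x∈P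
  ... | no x∉P  = contradiction (x , x∈S , x∉P) none
...   | yes (v , v∈S , v∉P) = inj₂ (ℕ.≤-trans (p⊆q⇒∣p∣≤∣q∣ S⊆P∪v) (∣p∪⁅x⁆∣≤1+∣p∣ P v))
  where
  S⊆P∪v : ∀ {x} → x ∈ S → x ∈ P ∪ ⁅ v ⁆
  S⊆P∪v {x} x∈S with x ∈? P | v ≟ x
  ... | yes x∈P | _        = x∈p∪q⁺ (inj₁ x∈P)
  ... | no _    | yes refl = x∈p∪q⁺ (inj₂ (x∈⁅x⁆ v))
  ... | no x∉P  | no v≢x   = contradiction (v , x , v∈S , x∈S , v≢x , v∉P , x∉P) noPair

half≤∣p∣⊎half≤∣∁p∣ : ∀ (P : Subset n) → ⌈ n /2⌉ ≤ ∣ P ∣ ⊎ ⌈ n /2⌉ ≤ ∣ ∁ P ∣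
half≤∣p∣⊎half≤∣∁p∣ {n} P with ⌈ n /2⌉ ≤? ∣ P ∣
... | yes large = inj₁ large
... | no small  = inj₂ (begin
  ⌈ n /2⌉                           ≡⟨ ℕ.m+n∸m≡n ⌊ n /2⌋ ⌈ n /2⌉ ⟨
  ⌊ n /2⌋ + ⌈ n /2⌉ ∸ ⌊ n /2⌋       ≡⟨ cong (_∸ ⌊ n /2⌋) (ℕ.⌊n/2⌋+⌈n/2⌉≡n n) ⟩
  n ∸ ⌊ n /2⌋                       ≤⟨ ℕ.∸-monoʳ-≤ n ∣P∣≤⌊n/2⌋ ⟩
  n ∸ ∣ P ∣                         ≡⟨ ∣∁p∣≡n∸∣p∣ P ⟨
  ∣ ∁ P ∣                           ∎)
  where
  open ≤-Reasoning
  ∣P∣≤⌊n/2⌋ : ∣ P ∣ ≤ ⌊ n /2⌋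
  -- By definition `⌈ n /2⌉` is `⌊ suc n /2⌋`, which is at most `⌊ suc (suc n) /2⌋`, that is,
  -- `suc ⌊ n /2⌋`.
  ∣P∣≤⌊n/2⌋ = ℕ.≤-pred (ℕ.≤-trans (ℕ.≰⇒> small) (ℕ.⌊n/2⌋-mono (ℕ.n≤1+n (suc n))))

-- Lower bound: a large two-colored set in every admissible coloring

-- Only one end of the edge has to lie in `P`; this is what leaves room for one extra vertex.
TouchingColors : Coloring n → Subset n → Color → Color → Set
TouchingColors c P p q =
  ∀ {i j} → i ∈ P → i ≢ j → color c i j ≡ p ⊎ color c i j ≡ q

-- The two ends of an edge cannot both be `v`, so every edge inside the enlarged set has an end in
-- `P`.
addVertex : ∀ (c : Coloring n) {p q} → TouchingColors c P p q → ∀ v →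
  AtMostTwoColors c (P ∪ ⁅ v ⁆)
addVertex {P = P} c {p} {q} touching v = p , q , two
  where
  two : ∀ i j → i ∈ P ∪ ⁅ v ⁆ → j ∈ P ∪ ⁅ v ⁆ → i ≢ j → color c i j ≡ p ⊎ color c i j ≡ q
  two i j i∈ j∈ i≢j with x∈p∪q⁻ P _ i∈ | x∈p∪q⁻ P _ j∈
  ... | inj₁ i∈P | _        = touching i∈P i≢j
  ... | inj₂ _   | inj₁ j∈P rewrite color-sym c i j = touching j∈P (≢-sym i≢j)
  ... | inj₂ i≡v | inj₂ j≡v =
    contradiction (trans (x∈⁅y⁆⇒x≡y v i≡v) (sym (x∈⁅y⁆⇒x≡y v j≡v))) i≢j

-- The second alternative covers the case where `P` is already everything and no vertex is left to
-- add.
enlarge : ∀ (c : Coloring n) {p q} → TouchingColors c P p q →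
  ∃[ S ] (AtMostTwoColors c S × (∣ P ∣ < ∣ S ∣ ⊎ n ≤ ∣ S ∣))
enlarge {n} {P} c {p} {q} touching with nonempty? (∁ P)
... | yes (v , v∈∁P) = P ∪ ⁅ v ⁆ , addVertex c touching v ,
  inj₁ (x∉p⇒∣p∣<∣p∪⁅x⁆∣ (x∈∁p⇒x∉p v∈∁P))
... | no empty = ⊤ , (p , q , λ i j _ _ → touching (x∉∁p⇒x∈p (λ i∈ → empty (i , i∈)))) ,
  inj₂ (ℕ.≤-reflexive (sym (∣⊤∣≡n n)))

forb⇒noRedBlueVertex : ∀ (c : Coloring n) → Forb n (rrb ∷ bbr ∷ rby ∷ []) c →
  i ≢ j → i ≢ k → color c i j ≡ r → color c i k ≢ b
forb⇒noRedBlueVertex {i = i} {j} {k} c forb i≢j i≢k ij≡r ik≡b =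
  -- Listing the common vertex `i` in the middle puts the red and the blue edge first; each color of
  -- the remaining edge `j k` then completes one of the three patterns.
  forb j i k (≢-sym i≢j) i≢k j≢k forbidden
  where
  j≢k : j ≢ k
  j≢k refl with () ← trans (sym ij≡r) ik≡b
  forbidden : Any (triangle c j i k ≈ₚ_) (rrb ∷ bbr ∷ rby ∷ [])
  forbidden rewrite color-sym c j i | ij≡r | ik≡b with color c j k
  ... | r = here (prep r (swap b r refl))
  ... | b = there (here (↭-trans (swap r b refl) (prep b (swap r b refl))))
  ... | y = there (there (here refl))

MeetsRed : Coloring n → Fin n → Set
MeetsRed c i = ∃[ j ] (i ≢ j × color c i j ≡ r)

meetsRed? : ∀ (c : Coloring n) → Decidable (MeetsRed c)
meetsRed? c i = any? λ j → ¬? (i ≟ j) ×-dec (color c i j ≟ᶜ r)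

redVertices : Coloring n → Subset n
redVertices c = filter (meetsRed? c)

redVertices-touching : ∀ (c : Coloring n) → Forb n (rrb ∷ bbr ∷ rby ∷ []) c →
  TouchingColors c (redVertices c) r y
redVertices-touching c forb {i} {k} i∈R i≢k
  with j , i≢j , ij≡r ← ∈-filter⁻ (meetsRed? c) i∈R | color c i k in ik≡
... | r = inj₁ refl
... | b = contradiction ik≡ (forb⇒noRedBlueVertex c forb i≢j i≢k ij≡r)
... | y = inj₂ refl

∁redVertices-touching : ∀ (c : Coloring n) → TouchingColors c (∁ (redVertices c)) b y
∁redVertices-touching c {i} {j} i∈∁R i≢j with color c i j in ij≡
... | r = contradiction (∈-filter⁺ (meetsRed? c) (j , i≢j , ij≡)) (x∈∁p⇒x∉p i∈∁R)
... | b = inj₁ refl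
... | y = inj₂ refl

large-twoColored : 2 ≤ n → ∀ (c : Coloring n) → Forb n (rrb ∷ bbr ∷ rby ∷ []) c →
  ∃[ S ] (⌈ n /2⌉ < ∣ S ∣ × AtMostTwoColors c S)
large-twoColored {n = suc (suc n)} (s≤s (s≤s z≤n)) c forb =
  [ extend (redVertices-touching c forb) , extend (∁redVertices-touching c) ]′
    (half≤∣p∣⊎half≤∣∁p∣ (redVertices c))
  where
  extend : ∀ {P p q} → TouchingColors c P p q → ⌈ suc (suc n) /2⌉ ≤ ∣ P ∣ →
    ∃[ S ] (⌈ suc (suc n) /2⌉ < ∣ S ∣ × AtMostTwoColors c S)
  extend touching half≤ with enlarge c touching
  ... | S , two , inj₁ P<S = S , ℕ.≤-<-trans half≤ P<S , two
  -- Here `2 ≤ n` enters: a single vertex would give `⌈ 1 /2⌉ ≡ 1`, with no strict inequality.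
  ... | S , two , inj₂ n≤S = S , ℕ.<-≤-trans (ℕ.⌈n/2⌉<n n) n≤S , two

-- Upper bound: two cliques joined by yellow edges

-- The Booleans tell on which side each end lies: `true` for the red clique, `false` for the blue
-- one.
edgeColor : Bool → Bool → Color
edgeColor true  true  = r
edgeColor false false = b
edgeColor true  false = y
edgeColor false true  = y

edgeColor-sym : ∀ s t → edgeColor s t ≡ edgeColor t s
edgeColor-sym true  true  = refl
edgeColor-sym true  false = refl
edgeColor-sym false true  = refl
edgeColor-sym false false = refl

twoCliques : Subset n → Coloring n
twoCliques P .color     i j = edgeColor (lookup P i) (lookup P j)
twoCliques P .color-sym i j = edgeColor-sym (lookup P i) (lookup P j)

forbidden⇒redBlue : ∀ (t : Pattern) → Any (t ≈ₚ_) (rrb ∷ bbr ∷ rby ∷ []) →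
  r ∈ₗ toList t × b ∈ₗ toList t
forbidden⇒redBlue t (here p) =
  ∈-resp-↭ (↭-sym p) (here refl) , ∈-resp-↭ (↭-sym p) (there (there (here refl)))
forbidden⇒redBlue t (there (here p)) =
  ∈-resp-↭ (↭-sym p) (there (there (here refl))) , ∈-resp-↭ (↭-sym p) (here refl)
forbidden⇒redBlue t (there (there (here p))) =
  ∈-resp-↭ (↭-sym p) (here refl) , ∈-resp-↭ (↭-sym p) (there (here refl))

-- Any two edges of a triangle share a vertex, which would have to lie in both cliques if one edge
-- were red and the other blue.
edgeColor-notRedBlue : ∀ s t u →
  let T = edgeColor s t ∷ edgeColor t u ∷ edgeColor s u ∷ [] in ¬ (r ∈ₗ T × b ∈ₗ T)
edgeColor-notRedBlue true  true  true  = from-no (b ∈ₗ? (r ∷ r ∷ r ∷ [])) ∘ proj₂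
edgeColor-notRedBlue true  true  false = from-no (b ∈ₗ? (r ∷ y ∷ y ∷ [])) ∘ proj₂
edgeColor-notRedBlue true  false true  = from-no (b ∈ₗ? (y ∷ y ∷ r ∷ [])) ∘ proj₂
edgeColor-notRedBlue true  false false = from-no (r ∈ₗ? (y ∷ b ∷ y ∷ [])) ∘ proj₁
edgeColor-notRedBlue false true  true  = from-no (b ∈ₗ? (y ∷ r ∷ y ∷ [])) ∘ proj₂
edgeColor-notRedBlue false true  false = from-no (r ∈ₗ? (y ∷ y ∷ b ∷ [])) ∘ proj₁
edgeColor-notRedBlue false false true  = from-no (r ∈ₗ? (b ∷ y ∷ y ∷ [])) ∘ proj₁
edgeColor-notRedBlue false false false = from-no (r ∈ₗ? (b ∷ b ∷ b ∷ [])) ∘ proj₁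

twoCliques-forb : ∀ (P : Subset n) → Forb n (rrb ∷ bbr ∷ rby ∷ []) (twoCliques P)
twoCliques-forb P i j k _ _ _ =
  edgeColor-notRedBlue (lookup P i) (lookup P j) (lookup P k) ∘
  forbidden⇒redBlue (triangle (twoCliques P) i j k)

twoCliques-touching : ∀ (P : Subset n) → TouchingColors (twoCliques P) P r y
twoCliques-touching P {i} {j} i∈P _ rewrite []=⇒lookup i∈P with lookup P j
... | true  = inj₁ refl
... | false = inj₂ refl

notThreeColors : ∀ {p q : Color} →
  r ≡ p ⊎ r ≡ q → b ≡ p ⊎ b ≡ q → ¬ (y ≡ p ⊎ y ≡ q)
notThreeColors (inj₁ refl) (inj₂ refl) (inj₁ ())
notThreeColors (inj₁ refl) (inj₂ refl) (inj₂ ())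
notThreeColors (inj₂ refl) (inj₁ refl) (inj₁ ())
notThreeColors (inj₂ refl) (inj₁ refl) (inj₂ ())

-- Otherwise `S` has two vertices in each clique: each pair spans a red or a blue edge, and an edge
-- across is yellow.
twoCliques-twoColored-size : ∀ (P : Subset n) → AtMostTwoColors (twoCliques P) S →
  ∣ S ∣ ≤ suc ∣ P ∣ ⊎ ∣ S ∣ ≤ suc ∣ ∁ P ∣
twoCliques-twoColored-size {S = S} P (p , q , two)
  with twoOutside-or-small S P | twoOutside-or-small S (∁ P)
... | inj₂ small | _ = inj₁ small
... | inj₁ _ | inj₂ small = inj₂ small
... | inj₁ (v , w , v∈S , w∈S , v≢w , v∉P , w∉P)
    | inj₁ (s , t , s∈S , t∈S , s≢t , s∉∁P , t∉∁P) =
  contradiction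
    (sees s∈S v∈S (λ { refl → v∉P (x∉∁p⇒x∈p s∉∁P) }) (clique s∉∁P) (∉⇒lookup P v∉P))
    (notThreeColors
      (sees s∈S t∈S s≢t (clique s∉∁P) (clique t∉∁P))
      (sees v∈S w∈S v≢w (∉⇒lookup P v∉P) (∉⇒lookup P w∉P)))
  where
  clique : i ∉ ∁ P → lookup P i ≡ true
  clique i∉∁P = []=⇒lookup (x∉∁p⇒x∈p i∉∁P)
  sees : ∀ {f g} → i ∈ S → j ∈ S → i ≢ j → lookup P i ≡ f → lookup P j ≡ g →
    edgeColor f g ≡ p ⊎ edgeColor f g ≡ q
  sees {i = i} {j = j} i∈S j∈S i≢j refl refl = two i j i∈S j∈S i≢j

-- Alternating the sides follows the recursion of `⌊_/2⌋` in steps of two, so both clique sizes come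
-- out by direct induction.
evens : ∀ n → Subset n
evens zero          = []
evens (suc zero)    = inside ∷ []
evens (suc (suc n)) = inside ∷ outside ∷ evens n

∣evens∣ : ∀ n → ∣ evens n ∣ ≡ ⌈ n /2⌉
∣evens∣ zero          = refl
∣evens∣ (suc zero)    = refl
∣evens∣ (suc (suc n)) = cong suc (∣evens∣ n)

∣∁evens∣ : ∀ n → ∣ ∁ (evens n) ∣ ≡ ⌊ n /2⌋
∣∁evens∣ zero          = refl
∣∁evens∣ (suc zero)    = refl
∣∁evens∣ (suc (suc n)) = cong suc (∣∁evens∣ n)

h₂-twoCliques-evens : 2 ≤ n → h₂ twoCliques (evens n) ≔ suc ⌈ n /2⌉
h₂-twoCliques-evens {n = n@(suc (suc m))} (s≤s (s≤s z≤n)) =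
  -- Vertex 1 is the first one in the blue clique; it exists because `2 ≤ n`.
  ( evens n ∪ ⁅ suc zero ⁆ , size
  , addVertex (twoCliques (evens n)) (twoCliques-touching (evens n)) (suc zero) ) ,
  λ { _ (S , refl , two) → [ bound (ℕ.≤-reflexive (∣evens∣ n))
                           , bound (ℕ.≤-trans (ℕ.≤-reflexive (∣∁evens∣ n)) (ℕ.⌊n/2⌋≤⌈n/2⌉ n)) ]′
                           (twoCliques-twoColored-size (evens n) two) }
  where
  size : ∣ evens n ∪ ⁅ suc zero ⁆ ∣ ≡ suc ⌈ n /2⌉
  size = cong (2 +_) (trans (cong ∣_∣ (∪-identityʳ (evens m))) (∣evens∣ m))
  bound : ∀ {s t} → t ≤ ⌈ n /2⌉ → s ≤ suc t → s ≤ suc ⌈ n /2⌉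
  bound t≤ s≤ = ℕ.≤-trans s≤ (s≤s t≤)

lemma3p5 : (n : ℕ) → 2 ≤ n → h₂[ n , rrb ∷ bbr ∷ rby ∷ [] ]≔ ⌈ n /2⌉ + 1
lemma3p5 n 2≤n rewrite ℕ.+-comm ⌈ n /2⌉ 1 =
  (twoCliques (evens n) , twoCliques-forb (evens n) , h₂-twoCliques-evens 2≤n) ,
  λ { k (c , forb , _ , isMax) →
      let S , half<S , two = large-twoColored 2≤n c forb
      -- As `k` is the maximum for `c`, it is at least the size of the two-colored set `S`.
      in ℕ.≤-trans half<S (isMax _ (S , refl , two)) }
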